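{- Let $G=(V,E,w)$ be a finite undirected graph with positive integer edge weights $w:E\to\mathbb{N}_{>0}$ and let $T=\{t_1,\dots,t_k\}\subseteq V$ be a non-empty set of terminals. Let $\phi\in V$ be an articulation point whose removal disconnects $G$ into multiple connected components $G_1,\dots,G_p$, and let $G_i$, $i\in\{1,\dots,p\}$, be a component that contains no terminal. Then no edge in $G_i$ (both endpoints in $G_i$) and no edge connecting a vertex of $G_i$ with $\phi$ can be part of a minimum multiterminal cut $\mathcal{C}(G)$ of $G$ with respect to $T$.
   Context: A multiterminal cut for terminals $T=\{t_1,\dots,t_k\}$ (pairwise distinct vertices) is a partition of $V$ into $k$ disjoint blocks $V_1,\dots,V_k$ with $t_j\in V_j$ for all $j$; its cut edges are the edges whose two endpoints lie in different blocks, and its weight is the sum of the weights of its cut edges. A minimum multiterminal cut is one of minimum weight, and $\mathcal{C}(G)$ denotes the set of cut edges of a minimum multiterminal cut of $G$. An articulation point is a vertex whose removal disconnects the graph into multiple connected components. -}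

module Defs where

open import Data.Bool.Base using (not; if_then_else_)
open import Data.Fin.Base using (Fin)
open import Data.Fin.Properties using (_≟_)
open import Data.Fin.Subset using (Subset; _∈_; _∉_; Nonempty)
open import Data.Nat.Base using (ℕ; _≤_; _<_)
open import Data.Nat.Properties using (+-0-commutativeMonoid)
open import Data.Product.Base using (_×_; _,_; proj₁; proj₂; ∃; ∃₂)
open import Data.Sum.Base using (_⊎_)
open import Data.Vec.Base using (lookup; tabulate)
open import Relation.Binary.Construct.Closure.ReflexiveTransitive using (Star)
open import Relation.Binary.PropositionalEquality using (_≡_; _≢_)
open import Relation.Nullary.Decidable using (does)

open import Algebra.Properties.CommutativeMonoid.Sum +-0-commutativeMonoid using (sum)

-- Edges are indexed by `Fin m`; the order of the two components of `ends e`
-- carries no meaning, see `Joins`. Loops and parallel edges are not excluded,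
-- so simple graphs are a special case.
record Graph : Set where
  field
    n m        : ℕ
    ends       : Fin m → Fin n × Fin n
    w          : Fin m → ℕ
    w-positive : ∀ e → 0 < w e

  Vertex : Set
  Vertex = Fin n

  Edge : Set
  Edge = Fin m

  Joins : Edge → Vertex → Vertex → Set
  Joins e u v = ends e ≡ (u , v) ⊎ ends e ≡ (v , u)

  Adjacent : Vertex → Vertex → Set
  Adjacent u v = ∃ λ e → Joins e u v

  AdjacentWithout : Vertex → Vertex → Vertex → Set
  AdjacentWithout φ u v = u ≢ φ × v ≢ φ × Adjacent u v

  -- For vertices other than φ: joined by a path in G − φ. The trivial path
  -- also relates φ to itself, so `IsComponentWithout` excludes φ separately.
  ConnectedWithout : Vertex → Vertex → Vertex → Set
  ConnectedWithout φ = Star (AdjacentWithout φ)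

  -- C is the vertex set of a connected component of G − φ.
  record IsComponentWithout (φ : Vertex) (C : Subset n) : Set where
    field
      nonempty  : Nonempty C
      avoids    : φ ∉ C
      connected : ∀ {u v} → u ∈ C → v ∈ C → ConnectedWithout φ u v
      maximal   : ∀ {u v} → u ∈ C → ConnectedWithout φ u v → v ∈ C

  -- G − φ has more than one connected component. G itself is not assumed
  -- to be connected.
  IsArticulationPoint : Vertex → Set
  IsArticulationPoint φ = ∃₂ λ C D →
    IsComponentWithout φ C × IsComponentWithout φ D × C ≢ D

  weight : Subset m → ℕ
  weight S = sum λ e → if lookup S e then w e else 0

  -- The partition V₁, …, Vₖ is given by the map sending each vertex to the
  -- index of its block.
  record MultiterminalCut {k : ℕ} (t : Fin k → Vertex) : Set where
    field
      block    : Vertex → Fin k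
      terminal : ∀ j → block (t j) ≡ j

    cutEdges : Subset m
    cutEdges = tabulate λ e →
      not (does (block (proj₁ (ends e)) ≟ block (proj₂ (ends e))))

  open MultiterminalCut public using (cutEdges)

  IsMinimum : {k : ℕ} {t : Fin k → Vertex} → MultiterminalCut t → Set
  IsMinimum {t = t} P =
    (Q : MultiterminalCut t) → weight (cutEdges P) ≤ weight (cutEdges Q)

  IsMinimumCutSet : {k : ℕ} → (Fin k → Vertex) → Subset m → Set
  IsMinimumCutSet t S =
    ∃ λ (P : MultiterminalCut t) → IsMinimum P × S ≡ cutEdges P

{-# OPTIONS --safe #-}

-- Moving all of C into the block of φ keeps every terminal in its block. Every
-- edge with an endpoint in C has its other endpoint in C ∪ {φ}, so it is uncut
-- afterwards, while all other edges are unaffected. As weights are positive, a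
-- cut containing such an edge is not minimum.
module Submission where

open import Defs
open import Algebra.Properties.CommutativeMonoid.Sum using (sum)
open import Data.Bool.Base using (true; false; not; if_then_else_)
open import Data.Fin.Base using (Fin; zero; suc)
open import Data.Fin.Properties using (_≟_)
open import Data.Fin.Subset using (Subset; _∈_; _∉_; _⊆_; _⊂_)
open import Data.Fin.Subset.Properties using (_∈?_)
open import Data.Nat.Base using (ℕ; NonZero; _≤_; _<_; z≤n)
open import Data.Nat.Properties
  using (+-0-commutativeMonoid; +-mono-≤; +-mono-<-≤; +-mono-≤-<; ≤-refl; <⇒≱)
open import Data.Product.Base using (_×_; _,_; proj₁; proj₂)
open import Data.Sum.Base using (inj₁; inj₂)
open import Data.Vec.Base using (lookup)
open import Data.Vec.Properties using (lookup⇒[]=; []=⇒lookup; lookup∘tabulate)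
open import Function.Base using (_∘_)
open import Function.Definitions using (Injective)
open import Relation.Binary.Construct.Closure.ReflexiveTransitive using (ε; _◅_)
open import Relation.Binary.PropositionalEquality
  using (_≡_; _≢_; refl; sym; trans; cong; subst₂)
open import Relation.Nullary using (yes; no; contradiction)
open import Relation.Nullary.Decidable using (dec-false)

private
  Σ : ∀ {n} → (Fin n → ℕ) → ℕ
  Σ = sum +-0-commutativeMonoid

sum-mono-≤ : ∀ {n} {f g : Fin n → ℕ} → (∀ i → f i ≤ g i) → Σ f ≤ Σ g
sum-mono-≤ {ℕ.zero}  f≤g = z≤n
sum-mono-≤ {ℕ.suc n} f≤g = +-mono-≤ (f≤g zero) (sum-mono-≤ (f≤g ∘ suc))

sum-mono-< : ∀ {n} {f g : Fin n → ℕ} → (∀ i → f i ≤ g i) →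
             ∀ i → f i < g i → Σ f < Σ g
sum-mono-< f≤g zero    fi<gi = +-mono-<-≤ fi<gi (sum-mono-≤ (f≤g ∘ suc))
sum-mono-< f≤g (suc i) fi<gi = +-mono-≤-< (f≤g zero) (sum-mono-< (f≤g ∘ suc) i fi<gi)

module _ (G : Graph) where
  open Graph G

  -- Inclusion gives a termwise comparison of the two sums. At the edge witnessing strictness the
  -- terms are 0 and `w e`, and `w e` is positive.
  weight-mono-⊂ : ∀ {S S′} → S ⊂ S′ → weight S < weight S′
  weight-mono-⊂ {S} {S′} (S⊆S′ , e , e∈S′ , e∉S) = sum-mono-< term-≤ e term-<
    where
    term : Subset m → Edge → ℕ
    term R d = if lookup R d then w d else 0

    term-≤ : ∀ d → term S d ≤ term S′ d
    term-≤ d with lookup S d in eq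
    ... | false = z≤n
    ... | true rewrite []=⇒lookup (S⊆S′ (lookup⇒[]= d S eq)) = ≤-refl

    term-< : term S e < term S′ e
    term-< rewrite []=⇒lookup e∈S′ with lookup S e in eq
    ... | false = w-positive e
    ... | true  = contradiction (lookup⇒[]= e S eq) e∉S

  module _ {k} {t : Fin k → Vertex} (P : MultiterminalCut t) where
    open MultiterminalCut P using (block)

    ∈-cutEdges⁻ : ∀ {e} → e ∈ cutEdges P →
                  block (proj₁ (ends e)) ≢ block (proj₂ (ends e))
    ∈-cutEdges⁻ {e} e∈P
      -- The membership equation is abstracted together with the decision, so that for equal blocks
      -- it reduces to `false ≡ true`.
      with block (proj₁ (ends e)) ≟ block (proj₂ (ends e))
         | trans (sym (lookup∘tabulate _ e)) ([]=⇒lookup e∈P)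
    ... | no  b≢b′ | _ = b≢b′
    ... | yes _    | ()

    ∈-cutEdges⁺ : ∀ {e} → block (proj₁ (ends e)) ≢ block (proj₂ (ends e)) →
                  e ∈ cutEdges P
    ∈-cutEdges⁺ {e} b≢b′ = lookup⇒[]= e _
      (trans (lookup∘tabulate _ e) (cong not (dec-false (_ ≟ _) b≢b′)))

  module _ {φ : Vertex} {C : Subset n} (isComponent : IsComponentWithout φ C) where
    open IsComponentWithout isComponent

    -- Precomposing a block map with this retraction moves `C` into the block of `φ`.
    collapse : Vertex → Vertex
    collapse v with v ∈? C
    ... | yes _ = φ
    ... | no  _ = v

    collapse-∈ : ∀ {v} → v ∈ C → collapse v ≡ φ
    collapse-∈ {v} v∈C with v ∈? C
    ... | yes _   = refl
    ... | no  v∉C = contradiction v∈C v∉C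

    collapse-∉ : ∀ {v} → v ∉ C → collapse v ≡ v
    collapse-∉ {v} v∉C with v ∈? C
    ... | yes v∈C = contradiction v∈C v∉C
    ... | no  _   = refl

    -- If `v` is not `φ`, the edge itself is a one-step path in G - φ, so maximality of the
    -- component puts `v` in `C`. If `v` is `φ`, it lies outside `C` and stays fixed.
    collapse-neighbour : ∀ {e u v} → Joins e u v → u ∈ C → collapse v ≡ φ
    collapse-neighbour {e} {u} {v} e-joins u∈C with v ≟ φ
    ... | yes refl = collapse-∉ avoids
    ... | no  v≢φ  = collapse-∈ (maximal u∈C ((u≢φ , v≢φ , e , e-joins) ◅ ε))
      where
      u≢φ : u ≢ φ
      u≢φ refl = avoids u∈C

    collapse-ends : ∀ {e u v} → Joins e u v → u ∈ C →
                    collapse (proj₁ (ends e)) ≡ collapse (proj₂ (ends e))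
    collapse-ends j@(inj₁ eq) u∈C rewrite eq =
      trans (collapse-∈ u∈C) (sym (collapse-neighbour j u∈C))
    collapse-ends j@(inj₂ eq) u∈C rewrite eq =
      trans (collapse-neighbour j u∈C) (sym (collapse-∈ u∈C))

    module _ {k} {t : Fin k → Vertex} (t∉C : ∀ j → t j ∉ C) (P : MultiterminalCut t) where
      open MultiterminalCut P using (block; terminal)

      collapsedCut : MultiterminalCut t
      collapsedCut = record
        { block    = block ∘ collapse
        ; terminal = λ j → trans (cong block (collapse-∉ (t∉C j))) (terminal j)
        }

      touching-∉-collapsedCut : ∀ {e u v} → Joins e u v → u ∈ C →
                                e ∉ cutEdges collapsedCut
      touching-∉-collapsedCut e-joins u∈C e∈Q =
        ∈-cutEdges⁻ collapsedCut e∈Q (cong block (collapse-ends e-joins u∈C))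

      -- An edge cut after the move has no end in `C`, so `collapse` fixes both ends and `P` gives
      -- them the same two distinct blocks.
      collapsedCut-⊆ : cutEdges collapsedCut ⊆ cutEdges P
      collapsedCut-⊆ {e} e∈Q with proj₁ (ends e) ∈? C | proj₂ (ends e) ∈? C
      ... | yes a∈C | _       =
        contradiction e∈Q (touching-∉-collapsedCut (inj₁ refl) a∈C)
      -- The edge is read in reverse here, so that its end in `C` comes first.
      ... | no  _   | yes b∈C =
        contradiction e∈Q (touching-∉-collapsedCut (inj₂ refl) b∈C)
      ... | no  a∉C | no  b∉C = ∈-cutEdges⁺ P
        (subst₂ (λ a b → block a ≢ block b) (collapse-∉ a∉C) (collapse-∉ b∉C)
          (∈-cutEdges⁻ collapsedCut e∈Q))

      -- If `P` cut `e`, then `e` would make the inclusion of `collapsedCut-⊆` strict, and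
      -- `collapsedCut` would be lighter than `P`.
      touching-∉-minimumCut : IsMinimum P → ∀ {e u v} → Joins e u v → u ∈ C →
                              e ∉ cutEdges P
      touching-∉-minimumCut P-min e-joins u∈C e∈P =
        <⇒≱ (weight-mono-⊂ (collapsedCut-⊆ , _ , e∈P , touching-∉-collapsedCut e-joins u∈C))
            (P-min collapsedCut)

lemma3 : (G : Graph) → let open Graph G in
    (k : ℕ) → .{{_ : NonZero k}} →
    (t : Fin k → Vertex) → Injective _≡_ _≡_ t →
    (φ : Vertex) → IsArticulationPoint φ →
    (C : Subset n) → IsComponentWithout φ C → (∀ j → t j ∉ C) →
    (S : Subset m) → IsMinimumCutSet t S →
    (∀ e u v → Joins e u v → u ∈ C → v ∈ C → e ∉ S) ×
    (∀ e u → Joins e u φ → u ∈ C → e ∉ S)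
lemma3 G k t _ φ _ C isComponent t∉C S (P , P-min , refl) =
  (λ e u v e-joins u∈C _ → uncut e-joins u∈C) , (λ e u e-joins u∈C → uncut e-joins u∈C)
  where
  open Graph G

  -- The end `v` is arbitrary, so that this covers both edges inside `C` and edges from `C` to `φ`.
  uncut : ∀ {e u v} → Joins e u v → u ∈ C → e ∉ cutEdges P
  uncut = touching-∉-minimumCut G isComponent t∉C P P-min
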